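{- For every integer $k \ge 4$ and all integers $p \ge k+2$ and $q \ge k+1$, $$r_k(p,q) \ge d\cdot\bigl(r_k(p-1,q)-1\bigr)+1, \qquad\text{where } d = \left\lfloor \frac{q-1}{k-2} \right\rfloor.$$
   Context: For integers $k,p,q$, the Ramsey number $r_k(p,q)$ is the smallest integer $N$ such that for every coloring of all $k$-element subsets of $\{1,\dots,N\}$ with the colors red and blue, there exist either $p$ elements of $\{1,\dots,N\}$ all of whose $k$-element subsets are red, or $q$ elements of $\{1,\dots,N\}$ all of whose $k$-element subsets are blue. -}

module Defs where

open import Data.Fin.Subset using (Subset; _⊆_; ∣_∣)
open import Data.Nat using (ℕ; _∸_; _≤_; NonZero; s≤s)
open import Data.Product using (Σ-syntax; ∃-syntax; _×_; proj₁)
open import Data.Sum using (_⊎_)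
open import Relation.Binary.PropositionalEquality using (_≡_)

data Color : Set where
  red blue : Color

-- Fin N plays the role of {1,…,N}.
KSubset : ℕ → ℕ → Set
KSubset k N = Σ[ e ∈ Subset N ] ∣ e ∣ ≡ k

Coloring : ℕ → ℕ → Set
Coloring k N = KSubset k N → Color

Monochromatic : ∀ {k N} → Coloring k N → Color → Subset N → Set
Monochromatic {k} {N} χ c A = (e : KSubset k N) → proj₁ e ⊆ A → χ e ≡ c

RamseyProperty : (k p q N : ℕ) → Set
RamseyProperty k p q N =
  (χ : Coloring k N) →
    (∃[ A ] ∣ A ∣ ≡ p × Monochromatic χ red A)
  ⊎ (∃[ B ] ∣ B ∣ ≡ q × Monochromatic χ blue B)

-- The graph of the function r_k(p,q): "N is r_k(p,q)".
-- A least element is unique, and one exists by Ramsey's theorem.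
record IsRamseyNumber (k p q N : ℕ) : Set where
  field
    ramsey  : RamseyProperty k p q N
    minimal : ∀ M → RamseyProperty k p q M → N ≤ M

4≤k⇒k∸2≢0 : ∀ {k} → 4 ≤ k → NonZero (k ∸ 2)
4≤k⇒k∸2≢0 (s≤s (s≤s (s≤s _))) = _

{-# OPTIONS --safe #-}
module Submission where

-- The bound follows from a stepping-up property, block-step: if k = m + 2 >= 4,
-- k <= p + 1 and d * m < q, then the Ramsey property of (k, p + 1, q) on d * n
-- points implies that of (k, p, q) on n points.  Take n + 1 to be the Ramsey
-- number of (p, q).  By minimality the latter property fails on n points, so
-- the former fails on d * n points; as the property is monotone in the number
-- of points, the Ramsey number of (p + 1, q) exceeds d * n.
--
-- For block-step, cut d * n points into d blocks of n points.  Given a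
-- coloring of the k-sets of n points, copy it inside every block; color a
-- k-set red if it has exactly k - 1 points in some block, and blue in all
-- remaining cases (blockColoring).
--
-- A blue set S of q points has at least k - 1 points in some block, as
-- d * m < q.  A point of S outside that block would complete k - 1 points
-- of S inside it to a red k-set.  So S lies in one block, where it is a blue
-- set of the given coloring.
--
-- A red set R of p + 1 points has at least p points in some block: otherwise
-- some k-subset of R has at most k - 2 points in each block, and is blue.
-- Indeed, if a block contains k - 2 points of R, add to these two points of R
-- outside the block (every other block receives at most 2 <= k - 2 points);
-- and if no block does, take any k-subset of R.  Any p points of R in a common
-- block form a red set of the given coloring.

open import Data.Fin using (Fin; zero; suc)
open import Data.Fin.Properties using (any?) renaming (_≟_ to _≟ᶠ_)
open import Data.Fin.Subset
  using (Subset; inside; outside; _⊆_; ∣_∣; ⊥; ⊤; _∩_)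
open import Data.Fin.Subset.Properties
  using (∣⊥∣≡0; ⊆-trans; ⊥⊆; out⊆; s⊆s; drop-∷-⊆; p⊆q⇒∣p∣≤∣q∣; ∣p∩q∣≤∣p∣;
         ∩-identityʳ; ∩-zeroʳ)
open import Data.Nat
  using (ℕ; zero; suc; _+_; _*_; _∸_; _/_; _≤_; _<_; _≥_; z≤n; s≤s; _≤?_; _≟_;
         _≤′_; ≤′-refl; ≤′-step)
open import Data.Nat.DivMod using (m/n*n≤m)
open import Data.Nat.Properties
open import Data.Product using (∃-syntax; _×_; _,_; proj₁)
open import Data.Sum using (inj₁; inj₂)
import Data.Sum as Sum
open import Data.Vec using ([]; _∷_; _++_; take; drop; here; there)
open import Data.Vec.Properties
  using (take++drop≡id; ++-injectiveˡ; ++-injectiveʳ)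
open import Function using (_∘_)
open import Relation.Binary.PropositionalEquality
open import Relation.Nullary using (¬_; yes; no; contradiction)
open import Defs

-- Finite subsets of concatenated ground sets

private
  variable
    m n : ℕ

∣++∣ : (p : Subset m) (q : Subset n) → ∣ p ++ q ∣ ≡ ∣ p ∣ + ∣ q ∣
∣++∣ []            q = refl
∣++∣ (inside ∷ p)  q = cong suc (∣++∣ p q)
∣++∣ (outside ∷ p) q = ∣++∣ p q

∣take∣+∣drop∣ : ∀ m (p : Subset (m + n)) → ∣ p ∣ ≡ ∣ take m p ∣ + ∣ drop m p ∣
∣take∣+∣drop∣ m p =
  trans (cong ∣_∣ (sym (take++drop≡id m p))) (∣++∣ (take m p) (drop m p))

take-++ : (p : Subset m) (q : Subset n) → take m (p ++ q) ≡ p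
take-++ {m} p q = ++-injectiveˡ _ p (take++drop≡id m (p ++ q))

drop-++ : (p : Subset m) (q : Subset n) → drop m (p ++ q) ≡ q
drop-++ {m} p q = ++-injectiveʳ (take m (p ++ q)) p (take++drop≡id m (p ++ q))

take-⊆ : ∀ m {p q : Subset (m + n)} → p ⊆ q → take m p ⊆ take m q
take-⊆ (suc m) {x ∷ p} {y ∷ q} p⊆q (there z) = there (take-⊆ m (drop-∷-⊆ p⊆q) z)
take-⊆ (suc m) {x ∷ p} {y ∷ q} p⊆q here with p⊆q here
... | here = here

drop-⊆ : ∀ m {p q : Subset (m + n)} → p ⊆ q → drop m p ⊆ drop m q
drop-⊆ zero                      p⊆q = p⊆q
drop-⊆ (suc m) {x ∷ p} {y ∷ q} p⊆q = drop-⊆ m (drop-∷-⊆ p⊆q)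

++-⊆ : {p p′ : Subset m} {q q′ : Subset n} →
       p ⊆ p′ → q ⊆ q′ → p ++ q ⊆ p′ ++ q′
++-⊆ {p = []}    {[]}     p⊆p′ q⊆q′ z         = q⊆q′ z
++-⊆ {p = x ∷ p} {y ∷ p′} p⊆p′ q⊆q′ (there z) =
  there (++-⊆ (drop-∷-⊆ p⊆p′) q⊆q′ z)
++-⊆ {p = x ∷ p} {y ∷ p′} p⊆p′ q⊆q′ here with p⊆p′ here
... | here = here

∣∩++∣ : (p : Subset (m + n)) (q : Subset m) (r : Subset n) →
        ∣ p ∩ (q ++ r) ∣ ≡ ∣ take m p ∩ q ∣ + ∣ drop m p ∩ r ∣
∣∩++∣ p             []            r = refl
∣∩++∣ (outside ∷ p) (_ ∷ q)       r = ∣∩++∣ p q r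
∣∩++∣ (inside ∷ p)  (outside ∷ q) r = ∣∩++∣ p q r
∣∩++∣ (inside ∷ p)  (inside ∷ q)  r = cong suc (∣∩++∣ p q r)

-- A set S with at least a points in B and at least b points outside B has a
-- subset with exactly a points in B and exactly b points outside B.
choose-split : ∀ (S B : Subset n) a b → a ≤ ∣ S ∩ B ∣ → ∣ S ∩ B ∣ + b ≤ ∣ S ∣ →
               ∃[ e ] e ⊆ S × ∣ e ∩ B ∣ ≡ a × ∣ e ∣ ≡ a + b
choose-split []            []            zero zero _ _ = [] , (λ ()) , refl , refl
choose-split (outside ∷ S) (_ ∷ B)       a b a≤ b≤ =
  let e , e⊆S , eB , ∣e∣ = choose-split S B a b a≤ b≤
  in outside ∷ e , out⊆ e⊆S , eB , ∣e∣
choose-split (inside ∷ S)  (inside ∷ B)  zero b a≤ (s≤s b≤) =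
  let e , e⊆S , eB , ∣e∣ = choose-split S B zero b z≤n b≤
  in outside ∷ e , out⊆ e⊆S , eB , ∣e∣
choose-split (inside ∷ S)  (inside ∷ B)  (suc a) b (s≤s a≤) (s≤s b≤) =
  let e , e⊆S , eB , ∣e∣ = choose-split S B a b a≤ b≤
  in inside ∷ e , s⊆s e⊆S , cong suc eB , cong suc ∣e∣
choose-split (inside ∷ S)  (outside ∷ B) a zero a≤ b≤ =
  let e , e⊆S , eB , ∣e∣ = choose-split S B a zero a≤
                             (subst (_≤ ∣ S ∣) (sym (+-identityʳ _)) (∣p∩q∣≤∣p∣ S B))
  in outside ∷ e , out⊆ e⊆S , eB , ∣e∣
choose-split (inside ∷ S)  (outside ∷ B) a (suc b) a≤ b≤ =
  let e , e⊆S , eB , ∣e∣ = choose-split S B a b a≤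
                             (≤-pred (subst (_≤ suc ∣ S ∣) (+-suc _ b) b≤))
  in inside ∷ e , s⊆s e⊆S , eB , trans (cong suc ∣e∣) (sym (+-suc a b))

choose : ∀ (S : Subset n) b → b ≤ ∣ S ∣ → ∃[ e ] e ⊆ S × ∣ e ∣ ≡ b
choose {n} S b b≤ =
  let e , e⊆S , _ , ∣e∣ = choose-split S ⊥ 0 b z≤n
                            (subst (λ x → x + b ≤ ∣ S ∣) (sym S∩⊥) b≤)
  in e , e⊆S , ∣e∣
  where
  S∩⊥ : ∣ S ∩ ⊥ ∣ ≡ 0
  S∩⊥ = trans (cong ∣_∣ (∩-zeroʳ S)) (∣⊥∣≡0 n)

-- Monotonicity of the Ramsey property

RamseyProperty-suc : ∀ {k p q N} →
                     RamseyProperty k p q N → RamseyProperty k p q (suc N)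
RamseyProperty-suc {k} {p} {q} {N} R χ = Sum.map extend extend (R χ↾)
  where
  χ↾ : Coloring k N
  χ↾ (e , ∣e∣) = χ (outside ∷ e , ∣e∣)

  extend : ∀ {s c} → ∃[ A ] ∣ A ∣ ≡ s × Monochromatic χ↾ c A →
           ∃[ A ] ∣ A ∣ ≡ s × Monochromatic χ c A
  extend {c = c} (A , ∣A∣ , mono) = outside ∷ A , ∣A∣ , mono′
    where
    mono′ : Monochromatic χ c (outside ∷ A)
    mono′ (outside ∷ e , ∣e∣) e⊆ = mono (e , ∣e∣) (drop-∷-⊆ e⊆)
    mono′ (inside ∷ e  , ∣e∣) e⊆ = contradiction (e⊆ here) λ ()

RamseyProperty-mono : ∀ {k p q M N} → M ≤ N →
                      RamseyProperty k p q M → RamseyProperty k p q N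
RamseyProperty-mono {k} {p} {q} {M} M≤N R = go (≤⇒≤′ M≤N)
  where
  go : ∀ {N} → M ≤′ N → RamseyProperty k p q N
  go ≤′-refl       = R
  go (≤′-step M≤N) = RamseyProperty-suc (go M≤N)

¬RamseyProperty-0 : ∀ {k p q} → 0 < p → 0 < q → ¬ RamseyProperty k p q 0
¬RamseyProperty-0 {k} 0<p 0<q R with R (λ _ → red)
... | inj₁ ([] , refl , _) = contradiction 0<p λ ()
... | inj₂ ([] , refl , _) = contradiction 0<q λ ()

module Blocks (n : ℕ) where

  -- Blocks of consecutive points

  -- The trace of a set on the i-th of d consecutive blocks of n points,
  -- read as a set of n points.
  slice : ∀ {d} → Subset (d * n) → Fin d → Subset n
  slice p zero    = take n p
  slice p (suc i) = slice (drop n p) i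

  -- The copy of a set of n points in the i-th block.
  embed : ∀ {d} → Fin d → Subset n → Subset (d * n)
  embed zero    p = p ++ ⊥
  embed (suc i) p = ⊥ {n} ++ embed i p

  slice-⊆ : ∀ {d} {p q : Subset (d * n)} (i : Fin d) →
            p ⊆ q → slice p i ⊆ slice q i
  slice-⊆ zero    p⊆q = take-⊆ n p⊆q
  slice-⊆ (suc i) p⊆q = slice-⊆ i (drop-⊆ n p⊆q)

  ∣slice∣≤ : ∀ {d} (p : Subset (d * n)) (i : Fin d) → ∣ slice p i ∣ ≤ ∣ p ∣
  ∣slice∣≤ p zero    rewrite ∣take∣+∣drop∣ n p = m≤m+n _ _
  ∣slice∣≤ p (suc i) rewrite ∣take∣+∣drop∣ n p =
    ≤-trans (∣slice∣≤ (drop n p) i) (m≤n+m _ _)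

  ∣slice∣+∣slice∣≤ : ∀ {d} (p : Subset (d * n)) (i j : Fin d) → i ≢ j →
                     ∣ slice p i ∣ + ∣ slice p j ∣ ≤ ∣ p ∣
  ∣slice∣+∣slice∣≤ p zero    zero    i≢j = contradiction refl i≢j
  ∣slice∣+∣slice∣≤ p zero    (suc j) i≢j rewrite ∣take∣+∣drop∣ n p =
    +-monoʳ-≤ _ (∣slice∣≤ (drop n p) j)
  ∣slice∣+∣slice∣≤ p (suc i) zero    i≢j
    rewrite ∣take∣+∣drop∣ n p | +-comm ∣ slice (drop n p) i ∣ ∣ take n p ∣ =
    +-monoʳ-≤ _ (∣slice∣≤ (drop n p) i)
  ∣slice∣+∣slice∣≤ p (suc i) (suc j) i≢j rewrite ∣take∣+∣drop∣ n p =
    ≤-trans (∣slice∣+∣slice∣≤ (drop n p) i j (i≢j ∘ cong suc)) (m≤n+m _ _)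

  slice-pigeonhole : ∀ d m (p : Subset (d * n)) → d * m < ∣ p ∣ →
                     ∃[ i ] m < ∣ slice {d} p i ∣
  slice-pigeonhole zero    m [] ()
  slice-pigeonhole (suc d) m p dm<p with suc m ≤? ∣ take n p ∣
  ... | yes m<  = zero , m<
  ... | no  m≮ =
    let i , m< = slice-pigeonhole d m (drop n p) (+-cancelˡ-< m _ _ (begin-strict
                   m + d * m                    <⟨ dm<p ⟩
                   ∣ p ∣                        ≡⟨ ∣take∣+∣drop∣ n p ⟩
                   ∣ take n p ∣ + ∣ drop n p ∣  ≤⟨ +-monoˡ-≤ _ (≮⇒≥ m≮) ⟩
                   m + ∣ drop n p ∣             ∎))
    in suc i , m<
    where open ≤-Reasoning

  slice-embed : ∀ {d} (i : Fin d) (p : Subset n) → slice (embed i p) i ≡ p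
  slice-embed {suc d} zero    p = take-++ p (⊥ {d * n})
  slice-embed {suc d} (suc i) p
    rewrite drop-++ (⊥ {n}) (embed i p) = slice-embed i p

  ∣embed∣ : ∀ {d} (i : Fin d) (p : Subset n) → ∣ embed i p ∣ ≡ ∣ p ∣
  ∣embed∣ {suc d} zero    p rewrite ∣++∣ p (⊥ {d * n}) | ∣⊥∣≡0 (d * n) =
    +-identityʳ _
  ∣embed∣ {suc d} (suc i) p rewrite ∣++∣ (⊥ {n}) (embed i p) | ∣⊥∣≡0 n =
    ∣embed∣ i p

  embed-⊆ : ∀ {d} (i : Fin d) {p : Subset n} {q : Subset (d * n)} →
            p ⊆ slice q i → embed i p ⊆ q
  embed-⊆ zero    {p} {q} p⊆ =
    subst (p ++ ⊥ ⊆_) (take++drop≡id n q) (++-⊆ p⊆ ⊥⊆)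
  embed-⊆ (suc i) {p} {q} p⊆ =
    subst (⊥ {n} ++ embed i p ⊆_) (take++drop≡id n q) (++-⊆ ⊥⊆ (embed-⊆ i p⊆))

  -- The set embed i ⊤ is the whole i-th block.
  ∣∩block∣ : ∀ {d} (p : Subset (d * n)) (i : Fin d) →
             ∣ p ∩ embed i ⊤ ∣ ≡ ∣ slice p i ∣
  ∣∩block∣ {suc d} p zero
    rewrite ∣∩++∣ p (⊤ {n}) (⊥ {d * n})
          | ∩-identityʳ (take n p)
          | ∩-zeroʳ (drop n p)
          | ∣⊥∣≡0 (d * n)
          = +-identityʳ _
  ∣∩block∣ {suc d} p (suc i)
    rewrite ∣∩++∣ p (⊥ {n}) (embed i ⊤)
          | ∩-zeroʳ (take n p)
          | ∣⊥∣≡0 n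
          = ∣∩block∣ (drop n p) i

  choose-in-block : ∀ {d} (S : Subset (d * n)) (i : Fin d) a b →
                    a ≤ ∣ slice S i ∣ → ∣ slice S i ∣ + b ≤ ∣ S ∣ →
                    ∃[ e ] e ⊆ S × ∣ slice e i ∣ ≡ a × ∣ e ∣ ≡ a + b
  choose-in-block S i a b a≤ b≤ =
    let e , e⊆S , eB , ∣e∣ = choose-split S (embed i ⊤) a b
                               (subst (a ≤_) (sym (∣∩block∣ S i)) a≤)
                               (subst (λ x → x + b ≤ ∣ S ∣) (sym (∣∩block∣ S i)) b≤)
    in e , e⊆S , trans (sym (∣∩block∣ e i)) eB , ∣e∣

  -- The block coloring

  -- A k-set inside one block gets the color of its copy under χ; a k-set with
  -- exactly k - 1 points in one block is red; every other k-set is blue.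
  blockColoring : ∀ {k} d → Coloring k n → Coloring k (d * n)
  blockColoring {k} d χ (e , _) with any? (λ (i : Fin d) → ∣ slice e i ∣ ≟ k)
  ... | yes (i , ∣ei∣) = χ (slice e i , ∣ei∣)
  ... | no  _ with any? (λ (i : Fin d) → suc ∣ slice e i ∣ ≟ k)
  ...   | yes _ = red
  ...   | no  _ = blue

  module _ {k d : ℕ} (χ : Coloring k n) where

    -- Two blocks cannot both contain k, or k and k - 1, points of a k-set
    -- when k is at least 2.
    same-block : 2 ≤ k → (e : KSubset k (d * n)) (i j : Fin d) →
                 ∣ slice (proj₁ e) i ∣ ≡ k → k ≤ suc ∣ slice (proj₁ e) j ∣ → i ≡ j
    same-block 2≤k (e , ∣e∣) i j ∣ei∣ ∣ej∣ with i ≟ᶠ j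
    ... | yes i≡j = i≡j
    ... | no  i≢j = contradiction (begin-strict
            k                                ≡⟨ +-identityʳ k ⟨
            k + 0                            <⟨ +-monoʳ-< k (≤-pred (≤-trans 2≤k ∣ej∣)) ⟩
            k + ∣ slice e j ∣                ≡⟨ cong (_+ ∣ slice e j ∣) ∣ei∣ ⟨
            ∣ slice e i ∣ + ∣ slice e j ∣    ≤⟨ ∣slice∣+∣slice∣≤ e i j i≢j ⟩
            ∣ e ∣                            ≡⟨ ∣e∣ ⟩
            k                                ∎) (<-irrefl refl)
      where open ≤-Reasoning

    blockColoring-inside : 2 ≤ k → (e : KSubset k (d * n)) (f : KSubset k n)
                           (i : Fin d) → slice (proj₁ e) i ≡ proj₁ f →
                           blockColoring d χ e ≡ χ f
    blockColoring-inside 2≤k E@(e , _) (f , ∣f∣) i refl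
      with any? (λ (i : Fin d) → ∣ slice e i ∣ ≟ k)
    ... | no  none = contradiction (i , ∣f∣) none
    ... | yes (j , ∣ej∣)
      with refl ← same-block 2≤k E i j ∣f∣ (m≤n⇒m≤1+n (≤-reflexive (sym ∣ej∣)))
      = cong (λ eq → χ (slice e i , eq)) (≡-irrelevant ∣ej∣ ∣f∣)

    blockColoring-red : 2 ≤ k → (e : KSubset k (d * n)) (i : Fin d) →
                        suc ∣ slice (proj₁ e) i ∣ ≡ k → blockColoring d χ e ≡ red
    blockColoring-red 2≤k E@(e , _) i ∣ei∣
      with any? (λ (i : Fin d) → ∣ slice e i ∣ ≟ k)
    ... | yes (j , ∣ej∣)
      with refl ← same-block 2≤k E j i ∣ej∣ (≤-reflexive (sym ∣ei∣))
      = contradiction (trans ∣ei∣ (sym ∣ej∣)) 1+n≢n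
    ... | no  _ with any? (λ (i : Fin d) → suc ∣ slice e i ∣ ≟ k)
    ...   | yes _    = refl
    ...   | no  none = contradiction (i , ∣ei∣) none

    blockColoring-blue : (e : KSubset k (d * n)) →
                         (∀ (i : Fin d) → suc ∣ slice (proj₁ e) i ∣ < k) →
                         blockColoring d χ e ≡ blue
    blockColoring-blue (e , _) small
      with any? (λ (i : Fin d) → ∣ slice e i ∣ ≟ k)
    ... | yes (i , ∣ei∣) =
          contradiction ∣ei∣ (<⇒≢ (<-trans (n<1+n _) (small i)))
    ... | no  _ with any? (λ (i : Fin d) → suc ∣ slice e i ∣ ≟ k)
    ...   | yes (i , ∣ei∣) = contradiction ∣ei∣ (<⇒≢ (small i))
    ...   | no  _          = refl

    slice-monochromatic : 2 ≤ k → ∀ {c s} (S : Subset (d * n)) (i : Fin d) →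
                          s ≤ ∣ slice S i ∣ →
                          Monochromatic (blockColoring d χ) c S →
                          ∃[ A ] ∣ A ∣ ≡ s × Monochromatic χ c A
    slice-monochromatic 2≤k {s = s} S i s≤ mono =
      let A , A⊆ , ∣A∣ = choose (slice S i) s s≤
      in A , ∣A∣ , λ (f , ∣f∣) f⊆A →
           let e : KSubset k (d * n)
               e = embed i f , trans (∣embed∣ i f) ∣f∣
           in trans (sym (blockColoring-inside 2≤k e (f , ∣f∣) i (slice-embed i f)))
                    (mono e (embed-⊆ i (⊆-trans f⊆A A⊆)))

  module _ {m d : ℕ} (χ : Coloring (2 + m) n) where

    private
      χ′ : Coloring (2 + m) (d * n)
      χ′ = blockColoring d χ

    blue-case : ∀ {q} → d * m < q → (S : Subset (d * n)) → ∣ S ∣ ≡ q →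
                Monochromatic χ′ blue S → ∃[ B ] ∣ B ∣ ≡ q × Monochromatic χ blue B
    blue-case {q} dm<q S refl mono with slice-pigeonhole d m S dm<q
    ... | i , m< with q ≤? ∣ slice S i ∣
    ...   | yes q≤ = slice-monochromatic χ (s≤s (s≤s z≤n)) S i q≤ mono
    ...   | no  q≰ =
      let e , e⊆S , ∣ei∣ , ∣e∣ = choose-in-block S i (suc m) 1 m<
                                   (subst (_≤ ∣ S ∣) (+-comm 1 _) (≰⇒> q≰))
          E : KSubset (2 + m) (d * n)
          E = e , trans ∣e∣ (+-comm (suc m) 1)
      in contradiction
           (trans (sym (blockColoring-red χ (s≤s (s≤s z≤n)) E i (cong suc ∣ei∣)))
                  (mono E e⊆S))
           λ ()

    -- Let k = m + 2 be at least 4.  A set of p + 1 >= k points with fewer than p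
    -- points in every block has a blue k-subset.
    spread⇒blue : ∀ {p} → 2 ≤ m → 2 + m ≤ suc p → (S : Subset (d * n)) →
                  ∣ S ∣ ≡ suc p → (∀ (i : Fin d) → ∣ slice S i ∣ < p) →
                  ∃[ e ] proj₁ e ⊆ S × χ′ e ≡ blue
    spread⇒blue {p} 2≤m k≤ S ∣S∣ spread
      with any? (λ (i : Fin d) → m ≤? ∣ slice S i ∣)
    ... | yes (i , m≤) =
      let e , e⊆S , ∣ei∣ , ∣e∣ = choose-in-block S i m 2 m≤ (begin
                                   ∣ slice S i ∣ + 2   ≡⟨ +-comm _ 2 ⟩
                                   2 + ∣ slice S i ∣   ≤⟨ s≤s (spread i) ⟩
                                   suc p               ≡⟨ ∣S∣ ⟨
                                   ∣ S ∣               ∎)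
          E : KSubset (2 + m) (d * n)
          E = e , trans ∣e∣ (+-comm m 2)
      in E , e⊆S , blockColoring-blue χ E (λ j → s≤s (s≤s (small e ∣ei∣ ∣e∣ j)))
      where
      open ≤-Reasoning
      small : ∀ e → ∣ slice e i ∣ ≡ m → ∣ e ∣ ≡ m + 2 → ∀ j → ∣ slice e j ∣ ≤ m
      small e ∣ei∣ ∣e∣ j with i ≟ᶠ j
      ... | yes refl = ≤-reflexive ∣ei∣
      ... | no  i≢j  = ≤-trans (+-cancelˡ-≤ m _ _ (begin
              m + ∣ slice e j ∣                ≡⟨ cong (_+ ∣ slice e j ∣) ∣ei∣ ⟨
              ∣ slice e i ∣ + ∣ slice e j ∣    ≤⟨ ∣slice∣+∣slice∣≤ e i j i≢j ⟩
              ∣ e ∣                            ≡⟨ ∣e∣ ⟩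
              m + 2                            ∎)) 2≤m
    ... | no  none =
      let e , e⊆S , ∣e∣ = choose S (2 + m) (subst (2 + m ≤_) (sym ∣S∣) k≤)
      in (e , ∣e∣) , e⊆S , blockColoring-blue χ (e , ∣e∣) (λ j →
           s≤s (s≤s (≤-trans (p⊆q⇒∣p∣≤∣q∣ (slice-⊆ j e⊆S))
                             (<⇒≤ (≰⇒> (λ m≤ → none (j , m≤)))))))

    red-case : ∀ {p} → 2 ≤ m → 2 + m ≤ suc p → (S : Subset (d * n)) →
               ∣ S ∣ ≡ suc p → Monochromatic χ′ red S →
               ∃[ A ] ∣ A ∣ ≡ p × Monochromatic χ red A
    red-case {p} 2≤m k≤ S ∣S∣ mono
      with any? (λ (i : Fin d) → p ≤? ∣ slice S i ∣)
    ... | yes (i , p≤) = slice-monochromatic χ (s≤s (s≤s z≤n)) S i p≤ mono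
    ... | no  none =
      let e , e⊆S , isBlue = spread⇒blue 2≤m k≤ S ∣S∣
                               (λ i → ≰⇒> (λ p≤ → none (i , p≤)))
      in contradiction (trans (sym (mono e e⊆S)) isBlue) λ ()

block-step : ∀ {m d p q n} → 2 ≤ m → 2 + m ≤ suc p → d * m < q →
             RamseyProperty (2 + m) (suc p) q (d * n) → RamseyProperty (2 + m) p q n
block-step {m} {d} {p} {q} {n} 2≤m k≤ dm<q R χ =
  Sum.map (λ (S , ∣S∣ , mono) → red-case {d = d} χ 2≤m k≤ S ∣S∣ mono)
          (λ (S , ∣S∣ , mono) → blue-case {d = d} χ dm<q S ∣S∣ mono)
          (R (blockColoring d χ))
  where open Blocks n

theorem5 : ∀ (k p q : ℕ) (k≥4 : k ≥ 4) → p ≥ k + 2 → q ≥ k + 1 →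
    ∀ (r r′ : ℕ) → IsRamseyNumber k p q r → IsRamseyNumber k (p ∸ 1) q r′ →
    let d = _/_ (q ∸ 1) (k ∸ 2) {{4≤k⇒k∸2≢0 k≥4}} in
    r ≥ d * (r′ ∸ 1) + 1
theorem5 (suc (suc m@(suc (suc _)))) (suc p) (suc q) k≥4@(s≤s (s≤s (s≤s (s≤s z≤n))))
         (s≤s p≥) q≥ r r′ isR isR′ =
  subst (_≤ r) (+-comm 1 _) (≰⇒> r≰)
  where
  open IsRamseyNumber
  d = q / m

  k≤p : 2 + m ≤ p
  k≤p = ≤-trans (subst (2 + m ≤_) (sym (+-suc (suc m) 1)) (s≤s (m≤m+n (suc m) 1)))
                p≥

  r≰ : ¬ r ≤ d * (r′ ∸ 1)
  r≰ r≤ = absurd r′ (ramsey isR′) (minimal isR′)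
    (block-step {d = d} (s≤s (s≤s z≤n)) (m≤n⇒m≤1+n k≤p) (s≤s (m/n*n≤m q m))
      (RamseyProperty-mono r≤ (ramsey isR)))
    where
    -- The case N = 0 is separate because 0 ∸ 1 is 0, so that minimality says nothing.
    absurd : ∀ N → RamseyProperty (2 + m) p (suc q) N →
             (∀ M → RamseyProperty (2 + m) p (suc q) M → N ≤ M) →
             ¬ RamseyProperty (2 + m) p (suc q) (N ∸ 1)
    absurd zero    R _   _  = ¬RamseyProperty-0 (≤-trans (s≤s z≤n) k≤p) (s≤s z≤n) R
    absurd (suc N) _ min R′ = 1+n≰n (min N R′)
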